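{- For every integer $\ell\ge 1$, the outer multiset dimension of the full $2$-ary tree $T_\ell^2$ of depth $\ell$ is $$\dim_{ms}(T_\ell^2)=\begin{cases}1,&\text{if }\ell=1\\3,&\text{if }\ell=2\\6,&\text{if }\ell=3\\13,&\text{if }\ell=4\\2^{\ell-4}\times 13,&\text{otherwise.}\end{cases}$$
   Context: For a simple connected graph $G=(V,E)$, $d_G(u,v)$ is the length of a shortest $u$–$v$ path. For $S=\{w_1,\ldots,w_t\}\subseteq V$ and $u\in V$, the multiset representation of $u$ with respect to $S$ is the multiset $\operatorname{m}(u|S)$ consisting of $d_G(u,w_1),\ldots,d_G(u,w_t)$, counted with multiplicity. A set $S\subseteq V$ is an outer multiset resolving set of $G$ if $\operatorname{m}(u|S)\ne \operatorname{m}(v|S)$ for every two distinct vertices $u,v\in V\setminus S$. The outer multiset dimension $\dim_{ms}(G)$ is the minimum cardinality of an outer multiset resolving set of $G$. A full $\delta$-ary tree is a rooted tree whose root has degree $\delta$, all of whose leaves are at the same distance from the root (this distance is the depth), and in which every vertex other than the root is either a leaf or a vertex of degree $\delta+1$. -}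

module Defs where

open import Data.Fin.Base using (Fin)
open import Data.Fin.Properties using (_≟_; any?)
open import Data.Fin.Subset using (Subset; _∉_; ∣_∣)
open import Data.Fin.Subset.Properties using (_∈?_)
open import Data.List.Base using (List; []; _∷_; length; filter; map; allFin)
import Data.List.Membership.Propositional as List
import Data.List.Membership.DecPropositional as DecMembership
open import Data.List.Relation.Binary.Permutation.Propositional using (_↭_)
open import Data.List.Relation.Unary.All as All using (All; []; _∷_)
open import Data.List.Relation.Unary.Any using (here; there)
open import Data.List.Relation.Unary.AllPairs using ([]; _∷_)
open import Data.List.Relation.Unary.Unique.Propositional using (Unique)
open import Data.Nat.Base using (ℕ; zero; suc; _≤_; z≤n; s≤s; _*_; _^_; _∸_)
open import Data.Product.Base using (Σ; ∃; _×_; _,_; proj₁; proj₂)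
open import Data.Sum.Base using (_⊎_)
open import Function.Base using (_∘_)
open import Relation.Binary.Core using (Rel)
import Relation.Binary.Definitions as B
open import Relation.Binary.PropositionalEquality using (_≡_; _≢_; refl; sym)
open import Relation.Nullary using (¬_; yes; no; contradiction)
open import Relation.Nullary.Decidable using (map′; _×-dec_; ¬?)
open import Relation.Unary using (Decidable)
open import Level using (0ℓ)

IsLeast : (ℕ → Set) → ℕ → Set
IsLeast P k = P k × (∀ j → P j → k ≤ j)

least : ∀ {P : ℕ → Set} → Decidable P → ∀ n → P n → ∃ (IsLeast P)
least P? zero    p = 0 , p , λ _ _ → z≤n
least P? (suc n) p with P? 0
... | yes p₀ = 0 , p₀ , λ _ _ → z≤n
... | no ¬p₀ with least (P? ∘ suc) n p
...   | k , pk , k-min = suc k , pk , λ where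
        zero    p₀ → contradiction p₀ ¬p₀
        (suc j) pj → s≤s (k-min j pj)

-- Adjacency is decidable because edge sets of finite graphs are finite sets.
record SimpleGraph : Set₁ where
  field
    order  : ℕ
  Vertex : Set
  Vertex = Fin order
  field
    Adj    : Rel Vertex 0ℓ
    Adj?   : B.Decidable Adj
    symm   : B.Symmetric Adj
    irrefl : ∀ {v} → ¬ Adj v v

  degree : Vertex → ℕ
  degree v = length (filter (Adj? v) (allFin order))

  data Walk : Vertex → Vertex → ℕ → Set where
    []  : ∀ {v} → Walk v v 0
    _∷_ : ∀ {u v w k} → Adj u v → Walk v w k → Walk u w (suc k)

  vertices : ∀ {u v k} → Walk u v k → List Vertex
  vertices {u} []      = u ∷ []
  vertices {u} (_ ∷ p) = u ∷ vertices p

  Path : Vertex → Vertex → ℕ → Set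
  Path u v k = Σ (Walk u v k) λ p → Unique (vertices p)

  Connected : Set
  Connected = ∀ u v → ∃ (Path u v)

  -- A cycle is an edge u v closed up by a path of length at least 2 from v
  -- back to u.
  Acyclic : Set
  Acyclic = ∀ u v k → Adj u v → Path v u k → ¬ (2 ≤ k)

  private
    PathAvoiding : List Vertex → Vertex → Vertex → ℕ → Set
    PathAvoiding xs u v k =
      Σ (Path u v k) λ p → All (List._∉ xs) (vertices (proj₁ p))

    pathAvoiding? : ∀ xs u v → Decidable (PathAvoiding xs u v)
    pathAvoiding? xs u v zero =
      map′ (λ { (refl , u∉xs) → ([] , [] ∷ []) , u∉xs ∷ [] })
           (λ { (([] , _) , u∉xs ∷ []) → refl , u∉xs })
           (u ≟ v ×-dec ¬? (u ∈ₗ? xs))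
      where open DecMembership _≟_ using () renaming (_∈?_ to _∈ₗ?_)
    pathAvoiding? xs u v (suc k) =
      map′ (λ { (u∉xs , w , e , (p , p!) , p∉) →
                (e ∷ p , All.map (λ y∉ u≡y → y∉ (here (sym u≡y))) p∉ ∷ p!)
                , u∉xs ∷ All.map (_∘ there) p∉ })
           (λ { ((e ∷ p , u∉p ∷ p!) , u∉xs ∷ p∉) →
                u∉xs , _ , e , (p , p!)
                , All.zipWith (λ { (u≢y , y∉) (here y≡u) → u≢y (sym y≡u)
                                 ; (u≢y , y∉) (there y∈) → y∉ y∈ })
                              (u∉p , p∉) })
           (¬? (u ∈ₗ? xs) ×-dec
            any? (λ w → Adj? u w ×-dec pathAvoiding? (u ∷ xs) w v k))
      where open DecMembership _≟_ using () renaming (_∈?_ to _∈ₗ?_)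

  path? : ∀ u v → Decidable (Path u v)
  path? u v k =
    map′ proj₁ (λ p → p , All.universal (λ _ ()) _) (pathAvoiding? [] u v k)

record ConnectedGraph : Set₁ where
  field
    graph     : SimpleGraph
  open SimpleGraph graph public
  field
    connected : Connected

  shortestPath : ∀ u v → ∃ (IsLeast (Path u v))
  shortestPath u v = least (path? u v) (proj₁ (connected u v)) (proj₂ (connected u v))

  dist : Vertex → Vertex → ℕ
  dist u v = proj₁ (shortestPath u v)

  -- Multisets of naturals are lists taken up to _↭_.
  m[_∣_] : Vertex → Subset order → List ℕ
  m[ u ∣ S ] = map (dist u) (filter (_∈? S) (allFin order))

  OuterMultisetResolving : Subset order → Set
  OuterMultisetResolving S =
    ∀ u v → u ∉ S → v ∉ S → u ≢ v → ¬ (m[ u ∣ S ] ↭ m[ v ∣ S ])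

  IsOuterMultisetDimension : ℕ → Set
  IsOuterMultisetDimension =
    IsLeast λ k → ∃ λ S → OuterMultisetResolving S × ∣ S ∣ ≡ k

record IsFullTree (δ ℓ : ℕ) (T : ConnectedGraph) : Set where
  open ConnectedGraph T
  field
    acyclic        : Acyclic
    root           : Vertex
    root-degree    : degree root ≡ δ
  -- The root is never a leaf, even when it has degree 1.
  IsLeaf : Vertex → Set
  IsLeaf v = v ≢ root × degree v ≡ 1
  field
    leaf-depth     : ∀ v → IsLeaf v → dist root v ≡ ℓ
    nonroot-degree : ∀ v → v ≢ root → IsLeaf v ⊎ degree v ≡ suc δ

-- Meant for ℓ ≥ 1: the value given at ℓ = 0 has no significance.
dimFullBinaryTree : ℕ → ℕ
dimFullBinaryTree 1 = 1
dimFullBinaryTree 2 = 3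
dimFullBinaryTree 3 = 6
dimFullBinaryTree 4 = 13
dimFullBinaryTree ℓ = 2 ^ (ℓ ∸ 4) * 13

{-# OPTIONS --safe #-}

-- In the binary tree two vertices on the same level see the same distances
-- outside the subtrees in which their ancestors differ.  In particular, two
-- siblings outside S are confused as soon as S has the same number of vertices
-- on every level of the two subtrees below them.  Listing the level counts of S
-- on a subtree of height n, the cheapest possibilities are 0,1 for n = 1; 0,1,2
-- and 0,0,3 for n = 2; and 0,0,1,5 alone for n = 3, so that the two halves of a
-- subtree of height 4 cannot both be cheapest, and it costs 6 + 7 = 13.  From
-- there on the cost at least doubles with the height.
--
-- Conversely, vertices on the same level of two sibling subtrees are told apart
-- once S has different numbers of leaves in the two subtrees: among the
-- vertices at the largest possible distance there are only leaves of the other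
-- subtree.  Three resolving sets of equal size with leaf counts a < b < c give
-- three sets one level up, with leaf counts a + b < a + c < b + c; at height 4
-- this starts with three sets of size 13.  Different levels are told apart by
-- the largest distance.

module Submission where

open import Algebra.Properties.CommutativeSemigroup using (interchange)
open import Data.Bool.Base using (Bool; true; false; if_then_else_)
import Data.Bool.Properties as Bool
open import Data.Empty using (⊥; ⊥-elim)
open import Data.Fin.Base using (Fin; zero; suc)
open import Data.Fin.Properties using (injective⇒≤) renaming (_≟_ to _≟ᶠ_)
open import Data.Fin.Subset using (Subset; _∉_; ∣_∣)
open import Data.Fin.Subset.Properties using (_∈?_)
open import Data.List.Base as List using (List; []; _∷_; _++_; length; map; filter; allFin; upTo)
open import Data.List.Membership.Propositional using (_∈_)
import Data.List.Membership.DecPropositional as DecMembership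
open import Data.List.Membership.Propositional.Properties
  using (∈-allFin; ∈-filter⁺; ∈-filter⁻; ∈-lookup; ∈-map⁺; ∈-map⁻; ∈-++⁺ˡ; ∈-++⁺ʳ; ∈-∃++)
open import Data.List.Membership.Propositional.Properties.WithK using (unique∧set⇒bag)
open import Data.List.Properties using (map-∘; map-tabulate; map-++)
open import Data.List.Relation.Binary.BagAndSetEquality using (∼bag⇒↭)
open import Data.List.Relation.Binary.Permutation.Propositional
  using (_↭_; ↭-refl; ↭-sym; ↭-trans; ↭-prep)
import Data.List.Relation.Binary.Permutation.Propositional.Properties as ↭
open import Data.List.Relation.Unary.All as All using (All; []; _∷_)
import Data.List.Relation.Unary.All.Properties as All
open import Data.List.Relation.Unary.AllPairs using ([]; _∷_)
open import Data.List.Relation.Unary.Any using (here; there)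
open import Data.List.Relation.Unary.Unique.Propositional using (Unique)
import Data.List.Relation.Unary.Unique.Propositional.Properties as Unique
open import Data.Nat.Base
open import Data.Nat.ListAction using (sum)
open import Data.Nat.ListAction.Properties using (sum-↭; sum-++)
open import Data.Nat.Properties
open import Data.Product.Base using (Σ; ∃; _×_; _,_; proj₁; proj₂)
open import Data.Sum.Base using (_⊎_; inj₁; inj₂)
open import Data.Unit.Base using (⊤)
open import Data.Vec.Base as Vec using (Vec; []; _∷_; zipWith; head; lookup)
open import Data.Vec.Properties using ([]=⇒lookup; lookup⇒[]=; lookup∘tabulate)
open import Function.Base using (_∘_; id)
open import Function.Bundles using (mk⇔)
open import Relation.Binary.Definitions using (tri<; tri≈; tri>; DecidableEquality)
open import Relation.Binary.PropositionalEquality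
open import Relation.Nullary using (¬_; Dec; yes; no; contradiction)
open import Relation.Nullary.Decidable using (map′; _×-dec_; _→-dec_; toWitness; True)

open import Defs

-- Distances in full binary trees

-- An address by turns from the root. As `here` exists at every `n`, inner vertices have addresses
-- too, and every position roots a subtree.
data Position : ℕ → Set where
  here  : ∀ {n} → Position n
  left  : ∀ {n} → Position n → Position (suc n)
  right : ∀ {n} → Position n → Position (suc n)

private variable
  n : ℕ

depth : Position n → ℕ
depth here      = 0
depth (left p)  = suc (depth p)
depth (right p) = suc (depth p)

treeDist : Position n → Position n → ℕ
treeDist here      q         = depth q
treeDist (left p)  here      = suc (depth p)
treeDist (left p)  (left q)  = treeDist p q
treeDist (left p)  (right q) = suc (depth p) + suc (depth q)
treeDist (right p) here      = suc (depth p)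
treeDist (right p) (left q)  = suc (depth p) + suc (depth q)
treeDist (right p) (right q) = treeDist p q

treeDist-refl : (p : Position n) → treeDist p p ≡ 0
treeDist-refl here      = refl
treeDist-refl (left p)  = treeDist-refl p
treeDist-refl (right p) = treeDist-refl p

data _⋖_ : Position n → Position n → Set where
  here-left  : here {suc n} ⋖ left here
  here-right : here {suc n} ⋖ right here
  left       : {p q : Position n} → p ⋖ q → left p ⋖ left q
  right      : {p q : Position n} → p ⋖ q → right p ⋖ right q

⋖-depth : {p q : Position n} → p ⋖ q → depth q ≡ suc (depth p)
⋖-depth here-left  = refl
⋖-depth here-right = refl
⋖-depth (left c)   = cong suc (⋖-depth c)
⋖-depth (right c)  = cong suc (⋖-depth c)

-- The Lipschitz property behind `treeDist≤walk`: no walk can approach its end faster than one unit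
-- of `treeDist` per step.
⋖-treeDist : {p q : Position n} → p ⋖ q → ∀ r →
             treeDist p r ≤ suc (treeDist q r) × treeDist q r ≤ suc (treeDist p r)
⋖-treeDist here-left here = z≤n , ≤-refl
⋖-treeDist here-left (left r) = ≤-refl , m≤n⇒m≤1+n (n≤1+n _)
⋖-treeDist here-left (right r) = m≤n⇒m≤1+n (n≤1+n _) , ≤-refl
⋖-treeDist here-right here = z≤n , ≤-refl
⋖-treeDist here-right (right r) = ≤-refl , m≤n⇒m≤1+n (n≤1+n _)
⋖-treeDist here-right (left r) = m≤n⇒m≤1+n (n≤1+n _) , ≤-refl
⋖-treeDist (left {p = p} c) here rewrite ⋖-depth c = m≤n⇒m≤1+n (n≤1+n _) , ≤-refl
⋖-treeDist (left c) (left r) = ⋖-treeDist c r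
⋖-treeDist (left c) (right r) rewrite ⋖-depth c = m≤n⇒m≤1+n (n≤1+n _) , ≤-refl
⋖-treeDist (right c) here rewrite ⋖-depth c = m≤n⇒m≤1+n (n≤1+n _) , ≤-refl
⋖-treeDist (right c) (right r) = ⋖-treeDist c r
⋖-treeDist (right c) (left r) rewrite ⋖-depth c = m≤n⇒m≤1+n (n≤1+n _) , ≤-refl

-- Walks, loop erasure and shortest paths

module Walks (T : ConnectedGraph) where
  open ConnectedGraph T
  open DecMembership (_≟ᶠ_ {order}) using () renaming (_∈?_ to _∈ᵥ?_)

  private variable
    u v w x : Vertex
    j k : ℕ

  snoc : Walk u v k → Adj v w → Walk u w (suc k)
  snoc []      e = e ∷ []
  snoc (a ∷ p) e = a ∷ snoc p e

  unsnoc : Walk u w (suc k) → ∃ λ v → Walk u v k × Adj v w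
  unsnoc (e ∷ [])        = _ , [] , e
  unsnoc (e ∷ p@(_ ∷ _)) with _ , q , e′ ← unsnoc p = _ , e ∷ q , e′

  module _ {P : Vertex → Set} where

    first : (p : Walk u v k) → All P (vertices p) → P u
    first []      (pu ∷ _) = pu
    first (_ ∷ _) (pu ∷ _) = pu

    -- Reverses `p` step by step onto the front of `q`. The predicate `P` travels along, so that
    -- avoiding a vertex survives the surgery.
    detour : (p : Walk u v j) (q : Walk u w k) → All P (vertices p) → All P (vertices q) →
             Σ (Walk v w (j + k)) λ r → All P (vertices r)
    detour []      q _         qs = q , qs
    detour {v = v} {w = w} {k = k} (e ∷ p) q (_ ∷ ps) qs =
      subst (λ n → Σ (Walk v w n) λ r → All P (vertices r)) (+-suc _ k)
            (detour p (symm e ∷ q) ps (first p ps ∷ qs))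

    PathWithin : Vertex → Vertex → ℕ → Set
    PathWithin u v k = ∃ λ j → Σ (Path u v j) λ p → j ≤ k × All P (vertices (proj₁ p))

    dropTo : (p : Walk u v k) → x ∈ vertices p → Unique (vertices p) → All P (vertices p) →
             PathWithin x v k
    dropTo []      (here refl) p!       ps       = _ , ([] , p!) , ≤-refl , ps
    dropTo (e ∷ p) (here refl) p!       ps       = _ , (e ∷ p , p!) , ≤-refl , ps
    dropTo (e ∷ p) (there x∈)  (_ ∷ p!) (_ ∷ ps)
      with j , q , j≤k , qs ← dropTo p x∈ p! ps = j , q , m≤n⇒m≤1+n j≤k , qs

    -- If the first vertex recurs in the already loop-free tail, the tail from that occurrence on is
    -- the path wanted; otherwise the edge can be put in front.
    eraseLoops : (p : Walk u v k) → All P (vertices p) → PathWithin u v k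
    eraseLoops [] ps = _ , ([] , [] ∷ []) , ≤-refl , ps
    eraseLoops {u = u} (e ∷ p) (pu ∷ ps) with eraseLoops p ps
    ... | j , (q , q!) , j≤k , qs with u ∈ᵥ? vertices q
    ...   | no u∉ = suc j , (e ∷ q , All.¬Any⇒All¬ _ u∉ ∷ q!) , s≤s j≤k , pu ∷ qs
    ...   | yes u∈ with i , r , i≤j , rs ← dropTo q u∈ q! qs =
              i , r , m≤n⇒m≤1+n (≤-trans i≤j j≤k) , rs

  dist≤ : Walk u v k → dist u v ≤ k
  dist≤ {u} {v} p with j , q , j≤k , _ ← eraseLoops {P = λ _ → ⊤} p (All.universal _ _) =
    ≤-trans (proj₂ (proj₂ (shortestPath u v)) j q) j≤k

  geodesic : ∀ u v → Walk u v (dist u v)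
  geodesic u v = proj₁ (proj₁ (proj₂ (shortestPath u v)))

  dist≡0⇒≡ : dist u v ≡ 0 → u ≡ v
  dist≡0⇒≡ {u} {v} eq with dist u v | geodesic u v
  dist≡0⇒≡ refl | _ | [] = refl

  length-vertices : (p : Walk u v k) → length (vertices p) ≡ suc k
  length-vertices []      = refl
  length-vertices (_ ∷ p) = cong suc (length-vertices p)

  lookup-injective : {xs : List Vertex} → Unique xs → ∀ {i j} →
                     List.lookup xs i ≡ List.lookup xs j → i ≡ j
  lookup-injective (_  ∷ _)   {zero}  {zero}  _  = refl
  lookup-injective (x∉ ∷ _)   {zero}  {suc j} eq = contradiction eq (All.lookup x∉ (∈-lookup j))
  lookup-injective (x∉ ∷ _)   {suc i} {zero}  eq = contradiction (sym eq) (All.lookup x∉ (∈-lookup i))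
  lookup-injective (_  ∷ xs!) {suc i} {suc j} eq = cong suc (lookup-injective xs! eq)

  -- By pigeonhole: a shortest path of length `k` visits `suc k` different vertices.
  dist<order : ∀ u v → dist u v < order
  dist<order u v with dist u v | proj₁ (proj₂ (shortestPath u v))
  ... | k | p , p! = subst (_≤ order) (length-vertices p) (injective⇒≤ (lookup-injective p!))

-- Levels, parents and subtrees in a rooted tree

module Rooting (T : ConnectedGraph) (acyclic : ConnectedGraph.Acyclic T)
               (root : ConnectedGraph.Vertex T) where
  open ConnectedGraph T
  open Walks T

  private variable
    u v w x c : Vertex
    j k : ℕ

  level : Vertex → ℕ
  level = dist root

  level-step : Adj u v → level v ≤ suc (level u)
  level-step {u} e = dist≤ (snoc (geodesic root u) e)

  level-root : level root ≡ 0
  level-root = n≤0⇒n≡0 (dist≤ [])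

  -- The number `j` of steps already made bounds the current level, and before the end of the walk
  -- it is smaller than `level u`.
  geodesic-levels : (p : Walk x u k) → level x ≤ j → j + k ≡ level u →
                    All (λ y → y ≡ u ⊎ level y < level u) (vertices p)
  geodesic-levels []      _   _  = inj₁ refl ∷ []
  geodesic-levels {j = j} (_∷_ {k = k} e p) x≤j eq =
    inj₂ (≤-trans (s≤s x≤j) (≤-trans (m≤m+n (suc j) k) (≤-reflexive eq′))) ∷
    geodesic-levels p (≤-trans (level-step e) (s≤s x≤j)) eq′
    where eq′ = trans (sym (+-suc j k)) eq

  Lower : Vertex → Vertex → Set
  Lower v u = Adj v u × level u ≤ level v

  -- Otherwise geodesics from w and u to the root, which avoid v, would yield a
  -- cycle through v.
  lower-unique : Lower v u → Lower v w → u ≡ w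
  lower-unique {v} {u} {w} (vu , u≤v) (vw , w≤v) with u ≟ᶠ w
  ... | yes u≡w = u≡w
  ... | no  u≢w = ⊥-elim (closing (eraseLoops (proj₁ q) (proj₂ q)))
    where
    avoids : Adj v x → level x ≤ level v → All (v ≢_) (vertices (geodesic root x))
    avoids {x} vx x≤v = All.map
      (λ { (inj₁ refl) refl → irrefl vx
         ; (inj₂ y<x)  refl → <⇒≱ y<x x≤v })
      (geodesic-levels (geodesic root x) (≤-reflexive level-root) refl)
    q = detour (geodesic root w) (geodesic root u) (avoids vw w≤v) (avoids vu u≤v)
    closing : PathWithin {P = v ≢_} w u (level w + level u) → ⊥
    closing (zero  , ([] , _) , _) = u≢w refl
    closing (suc k , (p , p!) , _ , ps) =
      acyclic u v (2 + k) (symm vu) (vw ∷ p , ps ∷ p!) (s≤s (s≤s z≤n))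

  Child : Vertex → Vertex → Set
  Child v w = Adj v w × level w ≡ suc (level v)

  Child⇒Lower : Child v w → Lower w v
  Child⇒Lower (e , eq) = symm e , ≤-trans (n≤1+n _) (≤-reflexive (sym eq))

  parent-unique : Child u w → Child v w → u ≡ v
  parent-unique c c′ = lower-unique (Child⇒Lower c) (Child⇒Lower c′)

  parent : level w ≡ suc k → ∃ λ v → Child v w × level v ≡ k
  parent {w} {k} eq with v , p , e ← unsnoc (subst (Walk root w) eq (geodesic root w)) =
    v , (e , trans eq (cong suc (sym v≡k))) , v≡k
    where v≡k = ≤-antisym (dist≤ p) (s≤s⁻¹ (subst (_≤ _) eq (level-step e)))

  nonroot-parent : v ≢ root → ∃ λ u → Child u v
  nonroot-parent {v} v≢r = go (level v) refl
    where
    go : ∀ k → level v ≡ k → ∃ λ u → Child u v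
    go zero    eq = contradiction (sym (dist≡0⇒≡ eq)) v≢r
    go (suc _) eq with u , c , _ ← parent eq = u , c

  Adj⇒Child : Adj v w → Child v w ⊎ Child w v
  Adj⇒Child {v} {w} e with <-cmp (level v) (level w)
  ... | tri< v<w _ _ = inj₁ (e , ≤-antisym (level-step e) v<w)
  ... | tri> _ _ w<v = inj₂ (symm e , ≤-antisym (level-step (symm e)) w<v)
  ... | tri≈ _ eq _  = ⊥-elim (level≢ (level v) refl)
    where
    level≢ : ∀ k → level v ≢ k
    level≢ zero    v≡0 =
      irrefl (subst (Adj v) (trans (sym (dist≡0⇒≡ (trans (sym eq) v≡0))) (dist≡0⇒≡ v≡0)) e)
    -- A neighbour `w` on the level of `v` would be a second lower neighbour beside the parent of
    -- `v`, hence equal to it, yet the parent lies one level higher up.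
    level≢ (suc k) v≡ with _ , c , u≡k ← parent v≡
      with refl ← lower-unique (e , ≤-reflexive (sym eq)) (Child⇒Lower c) =
      1+n≢n (trans (sym v≡) (trans eq u≡k))

  data Descent : Vertex → Vertex → ℕ → Set where
    []  : Descent v v 0
    _∷_ : Child u v → Descent v w k → Descent u w (suc k)

  Descent-snoc : Descent u v k → Child v w → Descent u w (suc k)
  Descent-snoc []      c = c ∷ []
  Descent-snoc (a ∷ p) c = a ∷ Descent-snoc p c

  descent : level w ≡ k → Descent root w k
  descent {k = zero}  eq = subst (λ v → Descent root v 0) (dist≡0⇒≡ eq) []
  descent {k = suc k} eq with u , c , u≡k ← parent eq = Descent-snoc (descent u≡k) c

  Descent-walk : Descent u w k → Walk u w k
  Descent-walk []            = []
  Descent-walk ((e , _) ∷ p) = e ∷ Descent-walk p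

  Descent-level : Descent u w k → level w ≡ level u + k
  Descent-level []                          = sym (+-identityʳ _)
  Descent-level {u} {k = suc k} ((_ , eq) ∷ p) =
    trans (Descent-level p) (trans (cong (_+ k) eq) (sym (+-suc (level u) k)))

  ancestor-unique : Descent u w k → Descent v w k → u ≡ v
  ancestor-unique []      []       = refl
  ancestor-unique (c ∷ p) (c′ ∷ q) with refl ← ancestor-unique p q = parent-unique c c′

  -- A certificate that the descendants of `v` form a full binary tree of height `h`; through it
  -- `at` turns positions into vertices.
  data Rooted : ℕ → Vertex → Set where
    leaf : (∀ {w} → ¬ Child v w) → Rooted 0 v
    node : ∀ {h x y} → Child v x → Child v y → x ≢ y →
           (∀ {w} → Child v w → w ≡ x ⊎ w ≡ y) →
           Rooted h x → Rooted h y → Rooted (suc h) v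

  at : ∀ {h} → Rooted h v → Position h → Vertex
  at {v = v} t         here          = v
  at (node _ _ _ _ l r) (left p)  = at l p
  at (node _ _ _ _ l r) (right p) = at r p

  at-descent : ∀ {h} (t : Rooted h v) p → Descent v (at t p) (depth p)
  at-descent t here = []
  at-descent (node vl _ _ _ l r) (left p)  = vl ∷ at-descent l p
  at-descent (node _ vr _ _ l r) (right p) = vr ∷ at-descent r p

  at-surjective : ∀ {h} (t : Rooted h v) → Descent v w k → ∃ λ p → at t p ≡ w
  at-surjective t [] = here , refl
  at-surjective (leaf none) (c ∷ _) = contradiction c none
  at-surjective (node _ _ _ all l r) (c ∷ p) with all c
  ... | inj₁ refl with q , eq ← at-surjective l p = left q , eq
  ... | inj₂ refl with q , eq ← at-surjective r p = right q , eq

  via-ancestor : Descent u v j → Descent u w k → Walk v w (j + k)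
  via-ancestor p q = proj₁ (detour {P = λ _ → ⊤} (Descent-walk p) (Descent-walk q)
                                   (All.universal _ _) (All.universal _ _))

  at-walk : ∀ {h} (t : Rooted h v) p q → Walk (at t p) (at t q) (treeDist p q)
  at-walk t                  here        q           = Descent-walk (at-descent t q)
  at-walk (node _ _ _ _ l _) (left p)    (left q)    = at-walk l p q
  at-walk (node _ _ _ _ _ r) (right p)   (right q)   = at-walk r p q
  at-walk t                  p@(left _)  q@(right _) = via-ancestor (at-descent t p) (at-descent t q)
  at-walk t                  p@(right _) q@(left _)  = via-ancestor (at-descent t p) (at-descent t q)
  at-walk t                  p@(left _)  here        =
    subst (Walk _ _) (+-identityʳ _) (via-ancestor (at-descent t p) [])
  at-walk t                  p@(right _) here        =
    subst (Walk _ _) (+-identityʳ _) (via-ancestor (at-descent t p) [])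

  at-level : ∀ {h} (t : Rooted h v) p → level (at t p) ≡ level v + depth p
  at-level t p = Descent-level (at-descent t p)

  at-depth : ∀ {h} (t : Rooted h v) p q → Child (at t p) (at t q) → depth q ≡ suc (depth p)
  at-depth {v} t p q (_ , eq) = +-cancelˡ-≡ (level v) _ _
    (trans (sym (at-level t q)) (trans eq (trans (cong suc (at-level t p)) (sym (+-suc _ _)))))

  -- Depths force a single step down. If it crossed between the subtrees, the child would have both
  -- `x` and `y` as ancestors equally far above it.
  Child⇒⋖ : ∀ {h} (t : Rooted h v) p q → Child (at t p) (at t q) → p ⋖ q
  Child⇒⋖ t p q c with at-depth t p q c
  Child⇒⋖ (node _ _ _ _ l r) here (left here) c | eq = here-left
  Child⇒⋖ (node _ _ _ _ l r) here (right here) c | eq = here-right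
  Child⇒⋖ (node _ _ _ _ l r) (left p) (left q) c | _ = left (Child⇒⋖ l p q c)
  Child⇒⋖ (node _ _ _ _ l r) (right p) (right q) c | _ = right (Child⇒⋖ r p q c)
  Child⇒⋖ (node _ _ x≢y _ l r) (left p) (right q) c | eq =
    contradiction (ancestor-unique (Descent-snoc (at-descent l p) c)
      (subst (Descent _ _) (suc-injective eq) (at-descent r q))) x≢y
  Child⇒⋖ (node _ _ x≢y _ l r) (right p) (left q) c | eq =
    contradiction (ancestor-unique (subst (Descent _ _) (suc-injective eq) (at-descent l q))
      (Descent-snoc (at-descent r p) c)) x≢y

  at-injective : ∀ {h} (t : Rooted h v) p q → at t p ≡ at t q → p ≡ q
  -- Equal vertices have equal levels, hence positions of equal depth; the induction carries this
  -- along so that `ancestor-unique` can separate the two subtrees.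
  at-injective {v} t p q eq = go t p q eq (+-cancelˡ-≡ (level v) _ _
      (trans (sym (at-level t p)) (trans (cong level eq) (at-level t q))))
    where
    go : ∀ {h v} (t : Rooted h v) p q → at t p ≡ at t q → depth p ≡ depth q → p ≡ q
    go t here here _ _ = refl
    go (node _ _ _ _ l r) (left p)  (left q)  eq deq = cong left (go l p q eq (suc-injective deq))
    go (node _ _ _ _ l r) (right p) (right q) eq deq = cong right (go r p q eq (suc-injective deq))
    go (node _ _ x≢y _ l r) (left p)  (right q) eq deq = contradiction
      (ancestor-unique (subst₂ (Descent _) eq (suc-injective deq) (at-descent l p)) (at-descent r q)) x≢y
    go (node _ _ x≢y _ l r) (right p) (left q)  eq deq = contradiction
      (ancestor-unique (at-descent l q) (subst₂ (Descent _) eq (suc-injective deq) (at-descent r p))) x≢y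

  module _ {h} (t : Rooted h root) where

    at-position : ∀ w → ∃ λ p → at t p ≡ w
    at-position w = at-surjective t (descent {w} refl)

    -- Along the walk `treeDist` to `q` drops by at most one per edge, and it ends at 0.
    treeDist≤walk : ∀ p q → Walk (at t p) (at t q) k → treeDist p q ≤ k
    treeDist≤walk p q ps = go p ps refl
      where
      go : ∀ {u k} p → Walk u (at t q) k → at t p ≡ u → treeDist p q ≤ k
      go p [] eq rewrite at-injective t p q eq = ≤-reflexive (treeDist-refl q)
      go p (_∷_ {v = v} e ps) refl with p′ , refl ← at-position v with Adj⇒Child e
      ... | inj₁ c = ≤-trans (proj₁ (⋖-treeDist (Child⇒⋖ t p p′ c) q)) (s≤s (go p′ ps refl))
      ... | inj₂ c = ≤-trans (proj₂ (⋖-treeDist (Child⇒⋖ t p′ p c) q)) (s≤s (go p′ ps refl))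

    dist-at : ∀ p q → dist (at t p) (at t q) ≡ treeDist p q
    dist-at p q = ≤-antisym (dist≤ (at-walk t p q)) (treeDist≤walk p q (geodesic _ _))

-- The shape of a full binary tree

module FullTree {ℓ} (T : ConnectedGraph) (full : IsFullTree 2 ℓ T) where
  open ConnectedGraph T
  open IsFullTree full
  open Walks T
  open Rooting T acyclic root

  neighbours : Vertex → List Vertex
  neighbours v = filter (Adj? v) (allFin order)

  neighbours! : ∀ v → Unique (neighbours v)
  neighbours! v = Unique.filter⁺ (Adj? v) (Unique.allFin⁺ order)

  ∈-neighbours : ∀ {v w} → Adj v w → w ∈ neighbours v
  ∈-neighbours {v} e = ∈-filter⁺ (Adj? v) (∈-allFin _) e

  neighbours-Adj : ∀ {v w} → w ∈ neighbours v → Adj v w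
  neighbours-Adj {v} w∈ = proj₂ (∈-filter⁻ (Adj? v) {xs = allFin order} w∈)

  Children : Vertex → Set
  Children v = ∃ λ x → ∃ λ y → Child v x × Child v y × x ≢ y ×
               (∀ {w} → Child v w → w ≡ x ⊎ w ≡ y)

  root-children : Children root
  root-children
    with neighbours root | neighbours! root
       | ∈-neighbours {root} | neighbours-Adj {root} | root-degree
  ... | x ∷ y ∷ [] | (x≢y ∷ []) ∷ _ | ∈N | N∈ | _ =
    x , y , child (here refl) , child (there (here refl)) , x≢y , complete
    where
    child : ∀ {w} → w ∈ x ∷ y ∷ [] → Child root w
    child w∈ with Adj⇒Child (N∈ w∈)
    ... | inj₁ c = c
    ... | inj₂ (_ , eq) = contradiction (trans (sym level-root) eq) λ ()
    complete : ∀ {w} → Child root w → w ≡ x ⊎ w ≡ y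
    complete (e , _) with ∈N e
    ... | here eq = inj₁ eq
    ... | there (here eq) = inj₂ eq

  -- Applied with `u` the parent among three neighbours; what remains are the two children.
  others : ∀ {u x y z : Vertex} (let xs = x ∷ y ∷ z ∷ []) → Unique xs → u ∈ xs →
           ∃ λ a → ∃ λ b → (a ∈ xs × a ≢ u) × (b ∈ xs × b ≢ u) × a ≢ b ×
           (∀ {w} → w ∈ xs → w ≢ u → w ≡ a ⊎ w ≡ b)
  others ((x≢y ∷ x≢z ∷ []) ∷ (y≢z ∷ []) ∷ _) (here refl) =
    _ , _ , (there (here refl) , ≢-sym x≢y) , (there (there (here refl)) , ≢-sym x≢z) , y≢z , λ where
      (here eq)                 w≢u → contradiction eq w≢u
      (there (here eq))         _   → inj₁ eq
      (there (there (here eq))) _   → inj₂ eq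
  others ((x≢y ∷ x≢z ∷ []) ∷ (y≢z ∷ []) ∷ _) (there (here refl)) =
    _ , _ , (here refl , x≢y) , (there (there (here refl)) , ≢-sym y≢z) , x≢z , λ where
      (here eq)                 _   → inj₁ eq
      (there (here eq))         w≢u → contradiction eq w≢u
      (there (there (here eq))) _   → inj₂ eq
  others ((x≢y ∷ x≢z ∷ []) ∷ (y≢z ∷ []) ∷ _) (there (there (here refl))) =
    _ , _ , (here refl , x≢z) , (there (here refl) , y≢z) , x≢y , λ where
      (here eq)                 _   → inj₁ eq
      (there (here eq))         _   → inj₂ eq
      (there (there (here eq))) w≢u → contradiction eq w≢u

  nonroot-children : ∀ {u v} → Child u v → degree v ≡ 3 → Children v
  nonroot-children {u} {v} uv deg
    with neighbours v | neighbours! v | ∈-neighbours {v} | neighbours-Adj {v} | deg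
  ... | x ∷ y ∷ z ∷ [] | N! | ∈N | N∈ | _
    with a , b , a∈ , b∈ , a≢b , all ← others N! (∈N (symm (proj₁ uv))) =
    a , b , child a∈ , child b∈ , a≢b , λ c → all (∈N (proj₁ c)) (≢u c)
    where
    child : ∀ {w} → w ∈ x ∷ y ∷ z ∷ [] × w ≢ u → Child v w
    child (w∈ , w≢u) with Adj⇒Child (N∈ w∈)
    ... | inj₁ c = c
    ... | inj₂ c = contradiction (parent-unique c uv) w≢u
    ≢u : ∀ {w} → Child v w → w ≢ u
    ≢u (_ , eq) refl = m≢1+m+n (level u) (trans eq (cong suc (trans (proj₂ uv) (+-comm 1 _))))

  children : ∀ v → level v ≢ ℓ → Children v
  children v lv≢ℓ with v ≟ᶠ root
  ... | yes refl = root-children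
  ... | no v≢r with nonroot-degree v v≢r
  ...   | inj₁ lf = contradiction (leaf-depth v lf) lv≢ℓ
  ...   | inj₂ deg with _ , uv ← nonroot-parent v≢r = nonroot-children uv deg

  -- Beyond level `ℓ` no vertex is a leaf, so the descent never stops; `level≤ℓ` plays this against
  -- `dist<order`.
  descendant : ∀ v → level v ≰ ℓ → ∀ k → ∃ λ w → level w ≡ level v + k
  descendant v v≰ℓ zero    = v , sym (+-identityʳ _)
  descendant v v≰ℓ (suc k)
    with w , eq ← descendant v v≰ℓ k
    with x , _ , (_ , x≡) , _ ← children w
           (λ w≡ℓ → v≰ℓ (m+n≤o⇒m≤o _ (≤-reflexive (trans (sym eq) w≡ℓ)))) =
    x , trans x≡ (trans (cong suc eq) (sym (+-suc _ k)))

  level≤ℓ : ∀ v → level v ≤ ℓ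
  level≤ℓ v with level v ≤? ℓ
  ... | yes v≤ℓ = v≤ℓ
  ... | no  v≰ℓ with w , eq ← descendant v v≰ℓ order =
    contradiction (≤-trans (m≤n+m order (level v)) (≤-reflexive (sym eq))) (<⇒≱ (dist<order root w))

  rooted : ∀ h v → level v + h ≡ ℓ → Rooted h v
  rooted zero v eq = leaf λ {w} c →
    1+n≰n (subst (_≤ ℓ) (trans (proj₂ c) (cong suc (trans (sym (+-identityʳ _)) eq))) (level≤ℓ w))
  rooted (suc h) v eq
    with x , y , vx , vy , x≢y , all ←
      children v (λ v≡ℓ → m≢1+m+n (level v) (trans v≡ℓ (trans (sym eq) (+-suc _ h)))) =
    node vx vy x≢y all (rooted h x (shift vx)) (rooted h y (shift vy))
    where
    shift : ∀ {w} → Child v w → level w + h ≡ ℓ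
    shift c = trans (cong (_+ h) (proj₂ c)) (trans (sym (+-suc _ h)) eq)

  tree : Rooted ℓ root
  tree = rooted ℓ root (cong (_+ ℓ) level-root)

-- Colourings of the positions

infix 4 _≟ₚ_

_≟ₚ_ : DecidableEquality (Position n)
here    ≟ₚ here    = yes refl
here    ≟ₚ left _  = no λ ()
here    ≟ₚ right _ = no λ ()
left _  ≟ₚ here    = no λ ()
left p  ≟ₚ left q  = map′ (cong left) (λ { refl → refl }) (p ≟ₚ q)
left _  ≟ₚ right _ = no λ ()
right _ ≟ₚ here    = no λ ()
right _ ≟ₚ left _  = no λ ()
right p ≟ₚ right q = map′ (cong right) (λ { refl → refl }) (p ≟ₚ q)

every? : {A : Position n → Set} → (∀ p → Dec (A p)) → Dec (∀ p → A p)
every? {zero}  A? = map′ (λ { h here → h }) (λ f → f here) (A? here)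
every? {suc _} A? =
  map′ (λ { (h , l , r) here → h ; (h , l , r) (left p) → l p ; (h , l , r) (right p) → r p })
       (λ f → f here , f ∘ left , f ∘ right)
       (A? here ×-dec every? (A? ∘ left) ×-dec every? (A? ∘ right))

depth≤height : (p : Position n) → depth p ≤ n
depth≤height here      = z≤n
depth≤height (left p)  = s≤s (depth≤height p)
depth≤height (right p) = s≤s (depth≤height p)

treeDist≤depth+height : (p q : Position n) → treeDist p q ≤ depth p + n
treeDist≤depth+height here q = depth≤height q
treeDist≤depth+height (left p)  here      = m≤m+n _ _
treeDist≤depth+height (left p)  (left q)  =
  m≤n⇒m≤1+n (≤-trans (treeDist≤depth+height p q) (+-monoʳ-≤ (depth p) (n≤1+n _)))
treeDist≤depth+height (left p)  (right q) = +-monoʳ-≤ (suc (depth p)) (s≤s (depth≤height q))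
treeDist≤depth+height (right p) here      = m≤m+n _ _
treeDist≤depth+height (right p) (left q)  = +-monoʳ-≤ (suc (depth p)) (s≤s (depth≤height q))
treeDist≤depth+height (right p) (right q) =
  m≤n⇒m≤1+n (≤-trans (treeDist≤depth+height p q) (+-monoʳ-≤ (depth p) (n≤1+n _)))

total : (Position n → ℕ) → ℕ
total {zero}  f = f here
total {suc _} f = f here + (total (f ∘ left) + total (f ∘ right))

total-cong : {f g : Position n → ℕ} → (∀ p → f p ≡ g p) → total f ≡ total g
total-cong {zero}  eq = eq here
total-cong {suc _} eq = cong₂ _+_ (eq here)
  (cong₂ _+_ (total-cong (eq ∘ left)) (total-cong (eq ∘ right)))

total-zero : {f : Position n → ℕ} → (∀ p → f p ≡ 0) → total f ≡ 0
total-zero {zero}  eq = eq here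
total-zero {suc _} eq = cong₂ _+_ (eq here)
  (cong₂ _+_ (total-zero (eq ∘ left)) (total-zero (eq ∘ right)))

Colouring : ℕ → Set
Colouring n = Position n → Bool

bit : Bool → ℕ
bit b = if b then 1 else 0

-- The comparison of numbers is outermost, so that a visible mismatch computes to 0 whatever the
-- colour.
hit : Bool → ℕ → ℕ → ℕ
hit b m k = if m ≡ᵇ k then bit b else 0

-- The multiset of the g p with p coloured, given by its multiplicities.
tally : Colouring n → (Position n → ℕ) → ℕ → ℕ
tally σ g k = total λ p → hit (σ p) (g p) k

size : Colouring n → ℕ
size σ = total (bit ∘ σ)

spectrum : Colouring n → Position n → ℕ → ℕ
spectrum σ p = tally σ (treeDist p)

profile : Colouring n → ℕ → ℕ
profile σ = tally σ depth

leaves : Colouring n → ℕ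
leaves {n} σ = profile σ n

Resolving : Colouring n → Set
Resolving σ = ∀ p q → σ p ≡ false → σ q ≡ false →
  (∀ k → spectrum σ p k ≡ spectrum σ q k) → p ≡ q

-- Two positions of a subtree see the same distances outside it when their depths agree; restricting
-- to equal depths therefore makes the property inherited by subtrees.
LevelResolving : Colouring n → Set
LevelResolving σ = ∀ p q → σ p ≡ false → σ q ≡ false → depth p ≡ depth q →
  (∀ k → spectrum σ p k ≡ spectrum σ q k) → p ≡ q

hit-miss : ∀ b {m k} → m < k → hit b m k ≡ 0
hit-miss b {zero}  {suc k} _         = refl
hit-miss b {suc m} {suc k} (s≤s m<k) = hit-miss b m<k

tally-far : (σ : Colouring n) {g : Position n → ℕ} {k : ℕ} → (∀ p → g p < k) → tally σ g k ≡ 0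
tally-far σ g<k = total-zero λ p → hit-miss (σ p) (g<k p)

tally-shift : (σ : Colouring n) (g : Position n → ℕ) (m : ℕ) {k : ℕ} →
              tally σ (λ p → m + g p) (m + k) ≡ tally σ g k
tally-shift σ g zero    = refl
tally-shift σ g (suc m) = tally-shift σ g m

spectrum-far : (σ : Colouring n) (p : Position n) {k : ℕ} → depth p + n < k → spectrum σ p k ≡ 0
spectrum-far σ p far = tally-far σ λ q → ≤-<-trans (treeDist≤depth+height p q) far

-- Resolving colourings and the two subtrees of the root

module _ (σ : Colouring (suc n)) where

  private
    -- The spectrum of a position in one subtree, as a function of its depth `m` there and of the
    -- contribution `s` of that subtree.
    aroundˡ aroundʳ : ℕ → ℕ → ℕ → ℕ
    aroundˡ m k s = hit (σ here) (suc m) k + (s + tally (σ ∘ right) (λ r → suc m + suc (depth r)) k)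
    aroundʳ m k s = hit (σ here) (suc m) k + (tally (σ ∘ left) (λ r → suc m + suc (depth r)) k + s)

  left-resolving : LevelResolving σ → LevelResolving (σ ∘ left)
  left-resolving res p q p∉ q∉ deq eq
    with refl ← res (left p) (left q) p∉ q∉ (cong suc deq)
                    (λ k → cong₂ (λ m → aroundˡ m k) deq (eq k)) = refl

  right-resolving : LevelResolving σ → LevelResolving (σ ∘ right)
  right-resolving res p q p∉ q∉ deq eq
    with refl ← res (right p) (right q) p∉ q∉ (cong suc deq)
                    (λ k → cong₂ (λ m → aroundʳ m k) deq (eq k)) = refl

  -- At distance `k` each child of the root sees level `k` of its own subtree and level `k - 2` of
  -- the other, so equal profiles give equal spectra.
  siblings-differ : LevelResolving σ → σ (left here) ≡ false → σ (right here) ≡ false →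
                    ¬ (∀ k → profile (σ ∘ left) k ≡ profile (σ ∘ right) k)
  siblings-differ res l∉ r∉ same =
    contradiction
      (res (left here) (right here) l∉ r∉ refl λ k → cong (hit (σ here) 1 k +_) (balance k)) λ ()
    where
    balance : ∀ k → profile (σ ∘ left) k + tally (σ ∘ right) (λ r → 2 + depth r) k ≡
                    tally (σ ∘ left) (λ r → 2 + depth r) k + profile (σ ∘ right) k
    -- The other subtree starts at distance 2 and contributes nothing at distances 0 and 1.
    balance 0 rewrite total-zero {n} {λ _ → 0} (λ _ → refl) =
      trans (+-identityʳ _) (same 0)
    balance 1 rewrite total-zero {n} {λ _ → 0} (λ _ → refl) =
      trans (+-identityʳ _) (same 1)
    balance (suc (suc k)) = trans (+-comm (profile (σ ∘ left) (2 + k)) _)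
                                  (cong₂ _+_ (sym (same k)) (same (2 + k)))

  far-left : ∀ p {k} → k ≡ suc (depth p) + suc n →
             spectrum σ (left p) k ≡ spectrum (σ ∘ left) p k + leaves (σ ∘ right)
  far-left p refl = cong₂ _+_ (hit-miss (σ here) (m<m+n (suc (depth p)) z<s))
    (cong (spectrum (σ ∘ left) p _ +_) (tally-shift (σ ∘ right) (suc ∘ depth) (suc (depth p))))

  far-right : ∀ p {k} → k ≡ suc (depth p) + suc n →
              spectrum σ (right p) k ≡ leaves (σ ∘ left) + spectrum (σ ∘ right) p k
  far-right p refl = cong₂ _+_ (hit-miss (σ here) (m<m+n (suc (depth p)) z<s))
    (cong (_+ spectrum (σ ∘ right) p _) (tally-shift (σ ∘ left) (suc ∘ depth) (suc (depth p))))

  -- At distance depth p + n + 2 from left p there are only leaves of the right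
  -- subtree, and vice versa.
  cross : ∀ p q → depth p ≡ depth q →
          (∀ k → spectrum σ (left p) k ≡ spectrum σ (right q) k) →
          leaves (σ ∘ left) ≡ leaves (σ ∘ right)
  cross p q deq eq = begin
    leaves (σ ∘ left)
      ≡⟨ +-identityʳ _ ⟨
    leaves (σ ∘ left) + 0
      ≡⟨ cong (leaves (σ ∘ left) +_) (spectrum-far (σ ∘ right) q (beyond (depth q))) ⟨
    leaves (σ ∘ left) + spectrum (σ ∘ right) q (reach (depth q))
      ≡⟨ far-right q refl ⟨
    spectrum σ (right q) (reach (depth q))
      ≡⟨ eq (reach (depth q)) ⟨
    spectrum σ (left p) (reach (depth q))
      ≡⟨ cong (spectrum σ (left p) ∘ reach) deq ⟨
    spectrum σ (left p) (reach (depth p))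
      ≡⟨ far-left p refl ⟩
    spectrum (σ ∘ left) p (reach (depth p)) + leaves (σ ∘ right)
      ≡⟨ cong (_+ leaves (σ ∘ right)) (spectrum-far (σ ∘ left) p (beyond (depth p))) ⟩
    leaves (σ ∘ right) ∎
    where
    open ≡-Reasoning
    reach : ℕ → ℕ
    reach m = suc m + suc n
    beyond : ∀ m → m + n < reach m
    beyond m = s≤s (+-monoʳ-≤ m (n≤1+n n))

  -- Within one subtree the contributions from outside agree at equal depths and cancel; between the
  -- subtrees `cross` contradicts the different leaf counts.
  node-resolving : LevelResolving (σ ∘ left) → LevelResolving (σ ∘ right) →
                   leaves (σ ∘ left) ≢ leaves (σ ∘ right) → LevelResolving σ
  node-resolving resˡ resʳ l≢r here here _ _ _ _ = refl
  node-resolving resˡ resʳ l≢r (left p) (left q) p∉ q∉ deq eq =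
    cong left (resˡ p q p∉ q∉ deq′ λ k →
      +-cancelʳ-≡ _ _ _ (+-cancelˡ-≡ (hit (σ here) (suc (depth p)) k) _ _
        (trans (eq k) (cong (λ m → aroundˡ m k (spectrum (σ ∘ left) q k)) (sym deq′)))))
    where deq′ = suc-injective deq
  node-resolving resˡ resʳ l≢r (right p) (right q) p∉ q∉ deq eq =
    cong right (resʳ p q p∉ q∉ deq′ λ k →
      +-cancelˡ-≡ _ _ _ (+-cancelˡ-≡ (hit (σ here) (suc (depth p)) k) _ _
        (trans (eq k) (cong (λ m → aroundʳ m k (spectrum (σ ∘ right) q k)) (sym deq′)))))
    where deq′ = suc-injective deq
  node-resolving resˡ resʳ l≢r (left p) (right q) _ _ deq eq =
    contradiction (cross p q (suc-injective deq) eq) l≢r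
  node-resolving resˡ resʳ l≢r (right p) (left q) _ _ deq eq =
    contradiction (cross q p (sym (suc-injective deq)) (sym ∘ eq)) l≢r

  reaches-across : 0 < leaves (σ ∘ left) → 0 < leaves (σ ∘ right) →
                   ∀ p → 0 < depth p → spectrum σ p (depth p + suc n) ≢ 0
  reaches-across _   0<r (left p)  _ eq = >⇒≢ 0<r (m+n≡0⇒n≡0 _ (trans (sym (far-left p refl)) eq))
  reaches-across 0<l _   (right p) _ eq = >⇒≢ 0<l (m+n≡0⇒m≡0 _ (trans (sym (far-right p refl)) eq))

  -- The deeper of two positions lies below the root and sees a coloured leaf across it, at distance
  -- its depth plus `suc n`, which is out of reach for the other.
  depth-determined : 0 < leaves (σ ∘ left) → 0 < leaves (σ ∘ right) →
                     ∀ p q → (∀ k → spectrum σ p k ≡ spectrum σ q k) → depth p ≡ depth q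
  depth-determined 0<l 0<r p q eq with <-cmp (depth p) (depth q)
  ... | tri≈ _ deq _ = deq
  ... | tri< p<q _ _ = contradiction
    (trans (sym (eq _)) (spectrum-far σ p (+-monoˡ-< (suc n) p<q)))
    (reaches-across 0<l 0<r q (m<n⇒0<n p<q))
  ... | tri> _ _ q<p = contradiction
    (trans (eq _) (spectrum-far σ q (+-monoˡ-< (suc n) q<p)))
    (reaches-across 0<l 0<r p (m<n⇒0<n q<p))

LevelResolving⇒Resolving : (σ : Colouring (suc n)) →
                           0 < leaves (σ ∘ left) → 0 < leaves (σ ∘ right) →
                           LevelResolving σ → Resolving σ
LevelResolving⇒Resolving σ 0<l 0<r res p q p∉ q∉ eq =
  res p q p∉ q∉ (depth-determined σ 0<l 0<r p q eq) eq

Resolving⇒LevelResolving : {σ : Colouring n} → Resolving σ → LevelResolving σ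
Resolving⇒LevelResolving res p q p∉ q∉ _ = res p q p∉ q∉

-- The lower bound

-- The numbers of `profile` as a vector, so that the cheap cases can be listed and matched on.
levels : Colouring n → Vec ℕ (suc n)
levels {zero}  σ = bit (σ here) ∷ []
levels {suc _} σ = bit (σ here) ∷ zipWith _+_ (levels (σ ∘ left)) (levels (σ ∘ right))

head-levels : (σ : Colouring n) → head (levels σ) ≡ bit (σ here)
head-levels {zero}  σ = refl
head-levels {suc _} σ = refl

coefficient : ∀ {m} → Vec ℕ m → ℕ → ℕ
coefficient []       _       = 0
coefficient (x ∷ _)  zero    = x
coefficient (_ ∷ xs) (suc k) = coefficient xs k

coefficient-+ : ∀ {m} (xs ys : Vec ℕ m) k →
                coefficient (zipWith _+_ xs ys) k ≡ coefficient xs k + coefficient ys k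
coefficient-+ []       []       _       = refl
coefficient-+ (_ ∷ _)  (_ ∷ _)  zero    = refl
coefficient-+ (_ ∷ xs) (_ ∷ ys) (suc k) = coefficient-+ xs ys k

profile-levels : (σ : Colouring n) → ∀ k → profile σ k ≡ coefficient (levels σ) k
profile-levels {zero}  σ zero    = refl
profile-levels {zero}  σ (suc k) = refl
profile-levels {suc n} σ zero
  rewrite total-zero {n} {λ _ → 0} (λ _ → refl) = +-identityʳ _
profile-levels {suc _} σ (suc k) =
  trans (cong₂ _+_ (profile-levels (σ ∘ left) k) (profile-levels (σ ∘ right) k))
        (sym (coefficient-+ (levels (σ ∘ left)) (levels (σ ∘ right)) k))

sum-zipWith-+ : ∀ {m} (xs ys : Vec ℕ m) → Vec.sum (zipWith _+_ xs ys) ≡ Vec.sum xs + Vec.sum ys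
sum-zipWith-+ [] [] = refl
sum-zipWith-+ (x ∷ xs) (y ∷ ys) =
  trans (cong (x + y +_) (sum-zipWith-+ xs ys)) (interchange +-commutativeSemigroup x y _ _)

size-levels : (σ : Colouring n) → size σ ≡ Vec.sum (levels σ)
size-levels {zero}  σ = sym (+-identityʳ _)
size-levels {suc _} σ = cong (bit (σ here) +_)
  (trans (cong₂ _+_ (size-levels (σ ∘ left)) (size-levels (σ ∘ right)))
         (sym (sum-zipWith-+ (levels (σ ∘ left)) (levels (σ ∘ right)))))

bit≡0⇒false : ∀ {b} → bit b ≡ 0 → b ≡ false
bit≡0⇒false {false} _ = refl

-- The head records the colour of the root of a subtree: siblings may share their level counts only
-- if both are coloured.
Distinct : Vec ℕ (suc n) → Vec ℕ (suc n) → Set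
Distinct xs ys = xs ≡ ys → head xs ≢ 0

siblings-distinct : (σ : Colouring (suc n)) → LevelResolving σ →
                    Distinct (levels (σ ∘ left)) (levels (σ ∘ right))
siblings-distinct σ res eq h≡0 = siblings-differ σ res
  (bit≡0⇒false (trans (sym (head-levels (σ ∘ left))) h≡0))
  (bit≡0⇒false (trans (sym (head-levels (σ ∘ right))) (trans (cong head (sym eq)) h≡0)))
  λ k → trans (profile-levels (σ ∘ left) k)
    (trans (cong (λ xs → coefficient xs k) eq) (sym (profile-levels (σ ∘ right) k)))

-- The level counts of cheap level-resolving colourings, as found by pairing those
-- of the two subtrees.
data Low₁ : Vec ℕ 2 → Set where
  [0,1] : Low₁ (0 ∷ 1 ∷ [])
  [0,2] : Low₁ (0 ∷ 2 ∷ [])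
  [1,1] : Low₁ (1 ∷ 1 ∷ [])
  large : ∀ {xs} → 3 ≤ Vec.sum xs → Low₁ xs

data Low₂ : Vec ℕ 3 → Set where
  [0,1,2] : Low₂ (0 ∷ 1 ∷ 2 ∷ [])
  [0,0,3] : Low₂ (0 ∷ 0 ∷ 3 ∷ [])
  large   : ∀ {xs} → 4 ≤ Vec.sum xs → Low₂ xs

data Low₃ : Vec ℕ 4 → Set where
  [0,0,1,5] : Low₃ (0 ∷ 0 ∷ 1 ∷ 5 ∷ [])
  large     : ∀ {xs} → 7 ≤ Vec.sum xs → Low₃ xs

literal : ∀ {m n} → {True (m ≤? n)} → m ≤ n
literal {m} {n} {t} = toWitness t

sum-node : ∀ {m i j} (b : ℕ) (xs ys : Vec ℕ m) → i ≤ Vec.sum xs → j ≤ Vec.sum ys →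
           i + j ≤ Vec.sum (b ∷ zipWith _+_ xs ys)
sum-node b xs ys i≤ j≤ = ≤-trans (+-mono-≤ i≤ j≤)
  (≤-trans (≤-reflexive (sym (sum-zipWith-+ xs ys))) (m≤n+m _ b))

low₁ : ∀ a b c → Distinct (bit b ∷ []) (bit c ∷ []) →
       Low₁ (bit a ∷ zipWith _+_ (bit b ∷ []) (bit c ∷ []))
low₁ a     false false ne = contradiction refl (ne refl)
low₁ false false true  _  = [0,1]
low₁ false true  false _  = [0,1]
low₁ false true  true  _  = [0,2]
low₁ true  false true  _  = [1,1]
low₁ true  true  false _  = [1,1]
low₁ true  true  true  _  = large literal

low₁-sum : ∀ {xs} → Low₁ xs → 1 ≤ Vec.sum xs
low₁-sum [0,1]     = literal
low₁-sum [0,2]     = literal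
low₁-sum [1,1]     = literal
low₁-sum (large h) = ≤-trans literal h

-- A sum below 4 needs subtrees of cost 1 and 2 under an uncoloured root, as two copies of `[0,1]`
-- are not distinct.
low₂ : ∀ a {xs ys} → Low₁ xs → Low₁ ys → Distinct xs ys → Low₂ (bit a ∷ zipWith _+_ xs ys)
low₂ a [0,1] [0,1] ne = contradiction refl (ne refl)
low₂ a {xs} {ys} (large h) y _ = large (sum-node (bit a) xs ys h (low₁-sum y))
low₂ a {xs} {ys} x (large h) _ = large (sum-node (bit a) xs ys (low₁-sum x) h)
low₂ false [0,1] [0,2] _ = [0,0,3]
low₂ false [0,1] [1,1] _ = [0,1,2]
low₂ false [0,2] [0,1] _ = [0,0,3]
low₂ false [1,1] [0,1] _ = [0,1,2]
low₂ true [0,1] [0,2] _ = large literal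
low₂ true [0,1] [1,1] _ = large literal
low₂ true [0,2] [0,1] _ = large literal
low₂ true [1,1] [0,1] _ = large literal
low₂ a {xs} {ys} [0,2] [0,2] _ = large (sum-node (bit a) xs ys (literal {2}) (literal {2}))
low₂ a {xs} {ys} [0,2] [1,1] _ = large (sum-node (bit a) xs ys (literal {2}) (literal {2}))
low₂ a {xs} {ys} [1,1] [0,2] _ = large (sum-node (bit a) xs ys (literal {2}) (literal {2}))
low₂ a {xs} {ys} [1,1] [1,1] _ = large (sum-node (bit a) xs ys (literal {2}) (literal {2}))

low₂-sum : ∀ {xs} → Low₂ xs → 3 ≤ Vec.sum xs
low₂-sum [0,1,2]   = literal
low₂-sum [0,0,3]   = literal
low₂-sum (large h) = ≤-trans literal h

-- Only the two different vectors of cost 3 under an uncoloured root stay below 7, and their order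
-- does not affect the sum.
low₃ : ∀ a {xs ys} → Low₂ xs → Low₂ ys → Distinct xs ys → Low₃ (bit a ∷ zipWith _+_ xs ys)
low₃ a {xs} {ys} (large h) y _ = large (sum-node (bit a) xs ys h (low₂-sum y))
low₃ a {xs} {ys} x (large h) _ = large (sum-node (bit a) xs ys (low₂-sum x) h)
low₃ a [0,1,2] [0,1,2] ne = contradiction refl (ne refl)
low₃ a [0,0,3] [0,0,3] ne = contradiction refl (ne refl)
low₃ false [0,1,2] [0,0,3] _ = [0,0,1,5]
low₃ false [0,0,3] [0,1,2] _ = [0,0,1,5]
low₃ true [0,1,2] [0,0,3] _ = large literal
low₃ true [0,0,3] [0,1,2] _ = large literal

low₃-sum : ∀ {xs} → Low₃ xs → 6 ≤ Vec.sum xs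
low₃-sum [0,0,1,5] = literal
low₃-sum (large h) = ≤-trans literal h

low₄ : ∀ a {xs ys} → Low₃ xs → Low₃ ys → Distinct xs ys → 13 ≤ Vec.sum (bit a ∷ zipWith _+_ xs ys)
low₄ a {xs} {ys} (large h) y _ = sum-node (bit a) xs ys h (low₃-sum y)
low₄ a {xs} {ys} x (large h) _ = sum-node (bit a) xs ys (low₃-sum x) h
low₄ a [0,0,1,5] [0,0,1,5] ne = contradiction refl (ne refl)

levels₁ : (σ : Colouring 1) → LevelResolving σ → Low₁ (levels σ)
levels₁ σ res = low₁ (σ here) _ _ (siblings-distinct σ res)

levels₂ : (σ : Colouring 2) → LevelResolving σ → Low₂ (levels σ)
levels₂ σ res = low₂ (σ here) (levels₁ _ (left-resolving σ res)) (levels₁ _ (right-resolving σ res))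
                        (siblings-distinct σ res)

levels₃ : (σ : Colouring 3) → LevelResolving σ → Low₃ (levels σ)
levels₃ σ res = low₃ (σ here) (levels₂ _ (left-resolving σ res)) (levels₂ _ (right-resolving σ res))
                        (siblings-distinct σ res)

double : ∀ m → 2 ^ suc m * 13 ≡ 2 ^ m * 13 + 2 ^ m * 13
double m = trans (*-distribʳ-+ 13 (2 ^ m) (2 ^ m + 0))
                 (cong (λ x → 2 ^ m * 13 + x * 13) (+-identityʳ (2 ^ m)))

2^m*13≤size : ∀ m (σ : Colouring (4 + m)) → LevelResolving σ → 2 ^ m * 13 ≤ size σ
2^m*13≤size zero σ res = subst (13 ≤_) (sym (size-levels σ))
  (low₄ (σ here) (levels₃ _ (left-resolving σ res)) (levels₃ _ (right-resolving σ res))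
        (siblings-distinct σ res))
2^m*13≤size (suc m) σ res = begin
  2 ^ suc m * 13                      ≡⟨ double m ⟩
  2 ^ m * 13 + 2 ^ m * 13             ≤⟨ +-mono-≤ (2^m*13≤size m _ (left-resolving σ res))
                                                  (2^m*13≤size m _ (right-resolving σ res)) ⟩
  size (σ ∘ left) + size (σ ∘ right)  ≤⟨ m≤n+m _ (bit (σ here)) ⟩
  size σ                              ∎
  where open ≤-Reasoning

dim≤size : ∀ ℓ (σ : Colouring (suc ℓ)) → LevelResolving σ → dimFullBinaryTree (suc ℓ) ≤ size σ
dim≤size 0 σ res = subst (1 ≤_) (sym (size-levels σ)) (low₁-sum (levels₁ σ res))
dim≤size 1 σ res = subst (3 ≤_) (sym (size-levels σ)) (low₂-sum (levels₂ σ res))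
dim≤size 2 σ res = subst (6 ≤_) (sym (size-levels σ)) (low₃-sum (levels₃ σ res))
dim≤size 3 σ res = 2^m*13≤size 0 σ res
dim≤size (suc (suc (suc (suc m)))) σ res = 2^m*13≤size (suc m) σ res

-- The upper bound

tip : Bool → Colouring 0
tip b _ = b

branch : Bool → Colouring n → Colouring n → Colouring (suc n)
branch b l r here      = b
branch b l r (left p)  = l p
branch b l r (right p) = r p

resolving? : ∀ N (σ : Colouring n) → Dec (∀ p q → σ p ≡ false → σ q ≡ false →
               All (λ k → spectrum σ p k ≡ spectrum σ q k) (upTo N) → p ≡ q)
resolving? N σ = every? λ p → every? λ q →
  (σ p Bool.≟ false) →-dec (σ q Bool.≟ false) →-dec
  All.all? (λ k → spectrum σ p k ≟ spectrum σ q k) (upTo N) →-dec (p ≟ₚ q)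

-- Deducing `p ≡ q` from the distances below `N` alone is a stronger demand, so the test is sound
-- for every `N`. The values used, `2 * n + 1`, cover all distances up to the diameter.
check : ∀ N (σ : Colouring n) → {True (resolving? N σ)} → Resolving σ
check N σ {t} p q p∉ q∉ eq = toWitness t p q p∉ q∉ (All.universal eq _)

-- Subscripts give the level counts.
twig₀₁ twig₀₂ twig₁₁ twig₁₂ : Colouring 1
twig₀₁ = branch false (tip false) (tip true)
twig₀₂ = branch false (tip true) (tip true)
twig₁₁ = branch true (tip false) (tip true)
twig₁₂ = branch true (tip true) (tip true)

bush₀₁₂ bush₀₀₃ : Colouring 2
bush₀₁₂ = branch false twig₀₁ twig₁₁
bush₀₀₃ = branch false twig₀₁ twig₀₂

bush₀₀₁₅ : Colouring 3
bush₀₀₁₅ = branch false bush₀₁₂ bush₀₀₃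

-- Named by their leaf counts, which are 9, 10 and 11 for m = 0.
sparse middling dense : ∀ m → Colouring (4 + m)
-- At height 4 each of the three joins `bush₀₀₁₅`, of size 6, to a subtree of size 7, itself made of
-- halves of sizes 3 and 4.
sparse zero      = branch false bush₀₀₁₅ (branch false bush₀₁₂ (branch true twig₀₁ twig₁₁))
sparse (suc m)   = branch false (sparse m) (middling m)
middling zero    = branch false bush₀₀₁₅ (branch false bush₀₁₂ (branch false twig₀₁ twig₁₂))
middling (suc m) = branch false (sparse m) (dense m)
dense zero       = branch false bush₀₀₁₅ (branch false bush₀₀₃ (branch false twig₀₁ twig₁₂))
dense (suc m)    = branch false (middling m) (dense m)

trio-leaves : ∀ m →
  0 < leaves (sparse m) × leaves (sparse m) < leaves (middling m) ×
  leaves (middling m) < leaves (dense m)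
trio-leaves zero = literal , literal , literal
trio-leaves (suc m) with 0<s , s<m , m<t ← trio-leaves m =
  ≤-trans 0<s (m≤m+n _ _) , +-monoʳ-< (leaves (sparse m)) m<t , +-monoˡ-< (leaves (dense m)) s<m

trio-resolving : ∀ m →
  LevelResolving (sparse m) × LevelResolving (middling m) × LevelResolving (dense m)
trio-resolving zero =
  Resolving⇒LevelResolving (check 9 (sparse 0)) ,
  Resolving⇒LevelResolving (check 9 (middling 0)) ,
  Resolving⇒LevelResolving (check 9 (dense 0))
trio-resolving (suc m) with rs , rm , rd ← trio-resolving m | _ , s<m , m<t ← trio-leaves m =
  node-resolving (sparse (suc m)) rs rm (<⇒≢ s<m) ,
  node-resolving (middling (suc m)) rs rd (<⇒≢ (<-trans s<m m<t)) ,
  node-resolving (dense (suc m)) rm rd (<⇒≢ m<t)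

trio-size : ∀ m →
  size (sparse m) ≡ 2 ^ m * 13 × size (middling m) ≡ 2 ^ m * 13 × size (dense m) ≡ 2 ^ m * 13
trio-size zero = refl , refl , refl
trio-size (suc m) with s , t , u ← trio-size m = add s t , add s u , add t u
  where
  add : ∀ {i j} → i ≡ 2 ^ m * 13 → j ≡ 2 ^ m * 13 → i + j ≡ 2 ^ suc m * 13
  add i≡ j≡ = trans (cong₂ _+_ i≡ j≡) (sym (double m))

optimal : ∀ ℓ → ∃ λ (σ : Colouring (suc ℓ)) → Resolving σ × size σ ≡ dimFullBinaryTree (suc ℓ)
optimal 0 = twig₀₁ , check 3 twig₀₁ , refl
optimal 1 = bush₀₁₂ , check 5 bush₀₁₂ , refl
optimal 2 = bush₀₀₁₅ , check 7 bush₀₀₁₅ , refl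
optimal 3 = sparse 0 , check 9 (sparse 0) , refl
-- The halves `sparse m` and `middling m` both contain coloured leaves, so different levels are told
-- apart as well.
optimal (suc (suc (suc (suc m)))) with 0<s , s<m , _ ← trio-leaves m =
  sparse (suc m) ,
  LevelResolving⇒Resolving (sparse (suc m)) 0<s (<-trans 0<s s<m) (proj₁ (trio-resolving (suc m))) ,
  proj₁ (trio-size (suc m))

-- From positions to vertices

positions : ∀ n → List (Position n)
positions zero    = here ∷ []
positions (suc n) = here ∷ map left (positions n) ++ map right (positions n)

∈-positions : (p : Position n) → p ∈ positions n
∈-positions {zero}  here      = here refl
∈-positions {suc _} here      = here refl
∈-positions {suc _} (left p)  = there (∈-++⁺ˡ (∈-map⁺ left (∈-positions p)))
∈-positions {suc n} (right p) = there (∈-++⁺ʳ (map left (positions n)) (∈-map⁺ right (∈-positions p)))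

positions! : ∀ n → Unique (positions n)
positions! zero    = [] ∷ []
positions! (suc n) = All.++⁺ (All.map⁺ (All.universal (λ _ ()) (positions n)))
                             (All.map⁺ (All.universal (λ _ ()) (positions n))) ∷
  Unique.++⁺ (Unique.map⁺ (λ { refl → refl }) (positions! n))
             (Unique.map⁺ (λ { refl → refl }) (positions! n)) disjoint
  where
  disjoint : ∀ {p} → ¬ (p ∈ map left (positions n) × p ∈ map right (positions n))
  disjoint (l , r) with _ , _ , refl ← ∈-map⁻ left l | _ , _ , () ← ∈-map⁻ right r

total≡sum : (f : Position n → ℕ) → total f ≡ sum (map f (positions n))
total≡sum {zero}  f = sym (+-identityʳ _)
total≡sum {suc n} f = cong (f here +_) (begin
  total (f ∘ left) + total (f ∘ right)
    ≡⟨ cong₂ _+_ (total≡sum (f ∘ left)) (total≡sum (f ∘ right)) ⟩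
  sum (map (f ∘ left) ps) + sum (map (f ∘ right) ps)
    ≡⟨ cong₂ (λ xs ys → sum xs + sum ys) (map-∘ ps) (map-∘ ps) ⟩
  sum (map f (map left ps)) + sum (map f (map right ps))
    ≡⟨ sum-++ (map f (map left ps)) _ ⟨
  sum (map f (map left ps) ++ map f (map right ps))
    ≡⟨ cong sum (map-++ f (map left ps) _) ⟨
  sum (map f (map left ps ++ map right ps)) ∎)
  where
  open ≡-Reasoning
  ps = positions n

-- Multisets compared by their multiplicities

count : ℕ → List ℕ → ℕ
count k xs = sum (map (λ x → hit true x k) xs)

hit-refl : ∀ b m → hit b m m ≡ bit b
hit-refl b zero    = refl
hit-refl b (suc m) = hit-refl b m

hit-false : ∀ m k → hit false m k ≡ 0
hit-false zero    zero    = refl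
hit-false zero    (suc _) = refl
hit-false (suc _) zero    = refl
hit-false (suc m) (suc k) = hit-false m k

hit⇒≡ : ∀ m k → hit true m k ≢ 0 → m ≡ k
hit⇒≡ zero    zero    _ = refl
hit⇒≡ zero    (suc _) h = contradiction refl h
hit⇒≡ (suc _) zero    h = contradiction refl h
hit⇒≡ (suc m) (suc k) h = cong suc (hit⇒≡ m k h)

count-∈ : ∀ {k} xs → count k xs ≢ 0 → k ∈ xs
count-∈         []       c≢0 = contradiction refl c≢0
count-∈ {k} (x ∷ xs) c≢0 with hit true x k in eq
... | zero  = there (count-∈ xs c≢0)
... | suc _ = here (sym (hit⇒≡ x k (λ z → contradiction (trans (sym eq) z) λ ())))

count-head : ∀ x xs → count x (x ∷ xs) ≢ 0
count-head x xs eq = contradiction (trans (cong (_+ count x xs) (sym (hit-refl true x))) eq) λ ()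

-- The head `x` has positive multiplicity in `ys`, so it can be brought to the front there and
-- cancelled on both sides.
count⇒↭ : ∀ xs ys → (∀ k → count k xs ≡ count k ys) → xs ↭ ys
count⇒↭ []       []       _  = ↭-refl
count⇒↭ []       (y ∷ ys) eq = contradiction (sym (eq y)) (count-head y ys)
count⇒↭ (x ∷ xs) ys       eq
  with as , bs , refl ← ∈-∃++ (count-∈ ys (count-head x xs ∘ trans (eq x))) =
  ↭-trans (↭-prep x (count⇒↭ xs (as ++ bs) λ k → +-cancelˡ-≡ (hit true x k) _ _
             (trans (eq k) (sum-↭ (↭.map⁺ _ (↭.shift x as bs))))))
          (↭-sym (↭.shift x as bs))

∉⇒false : ∀ {S : Subset n} {v} → v ∉ S → lookup S v ≡ false
∉⇒false v∉ = Bool.¬-not λ eq → v∉ (lookup⇒[]= _ _ eq)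

false⇒∉ : ∀ {S : Subset n} {v} → lookup S v ≡ false → v ∉ S
false⇒∉ eq v∈ = contradiction (trans (sym eq) ([]=⇒lookup v∈)) λ ()

-- Membership in `S` moves from the filter into the colour argument of `hit`, which gives the shape
-- of a `tally`.
count-filter : (S : Subset n) (g : Fin n → ℕ) (k : ℕ) → ∀ vs →
               count k (map g (filter (_∈? S) vs)) ≡ sum (map (λ v → hit (lookup S v) (g v) k) vs)
count-filter S g k []       = refl
count-filter S g k (v ∷ vs) with v ∈? S
... | yes v∈ rewrite []=⇒lookup v∈ = cong (hit true (g v) k +_) (count-filter S g k vs)
... | no  v∉ rewrite ∉⇒false v∉ | hit-false (g v) k = count-filter S g k vs

∣∣≡sum : (S : Subset n) → ∣ S ∣ ≡ sum (map (bit ∘ lookup S) (allFin n))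
∣∣≡sum S = trans (go S) (cong sum (sym (map-tabulate id (bit ∘ lookup S))))
  where
  go : (S : Subset n) → ∣ S ∣ ≡ sum (List.tabulate (bit ∘ lookup S))
  go []          = refl
  go (true ∷ S)  = cong suc (go S)
  go (false ∷ S) = go S

-- Resolving sets of vertices and resolving colourings

module _ {ℓ} (T : ConnectedGraph) (full : IsFullTree 2 ℓ T) where
  open ConnectedGraph T
  open IsFullTree full using (acyclic; root)
  open Rooting T acyclic root
  open FullTree T full

  private
    f : Position ℓ → Vertex
    f = at tree

  -- Both lists are free of repetitions and contain every vertex.
  all-vertices : map f (positions ℓ) ↭ allFin order
  all-vertices = ∼bag⇒↭ (unique∧set⇒bag
    (Unique.map⁺ (λ {p} {q} → at-injective tree p q) (positions! ℓ))
    (Unique.allFin⁺ order)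
    λ {v} → mk⇔ (λ _ → ∈-allFin v) λ _ → let p , p↦v = at-position tree v in
      subst (_∈ map f (positions ℓ)) p↦v (∈-map⁺ f (∈-positions p)))

  sum-vertices : (h : Vertex → ℕ) → sum (map h (allFin order)) ≡ total (h ∘ f)
  sum-vertices h = begin
    sum (map h (allFin order))        ≡⟨ sum-↭ (↭.map⁺ h all-vertices) ⟨
    sum (map h (map f (positions ℓ))) ≡⟨ cong sum (map-∘ (positions ℓ)) ⟨
    sum (map (h ∘ f) (positions ℓ))   ≡⟨ total≡sum (h ∘ f) ⟨
    total (h ∘ f)                     ∎
    where open ≡-Reasoning

  -- The bridge from the graph to positions, resting on `dist-at`. Pointwise agreement with `σ`
  -- serves both directions: it is `refl` for a given set, and `lookup-coloured` for a given
  -- colouring.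
  count-m : (S : Subset order) {σ : Colouring ℓ} → (∀ p → lookup S (f p) ≡ σ p) →
            ∀ p k → count k m[ f p ∣ S ] ≡ spectrum σ p k
  count-m S S≗σ p k = trans (count-filter S (dist (f p)) k (allFin order))
    (trans (sum-vertices _) (total-cong λ q → cong₂ (λ b m → hit b m k) (S≗σ q) (dist-at tree p q)))

  ∣∣≡size : (S : Subset order) {σ : Colouring ℓ} → (∀ p → lookup S (f p) ≡ σ p) → ∣ S ∣ ≡ size σ
  ∣∣≡size S S≗σ = trans (∣∣≡sum S) (trans (sum-vertices _) (total-cong (cong bit ∘ S≗σ)))

  outer⇒Resolving : {S : Subset order} → OuterMultisetResolving S → Resolving (lookup S ∘ f)
  outer⇒Resolving {S} res p q p∉ q∉ eq with p ≟ₚ q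
  ... | yes p≡q = p≡q
  ... | no  p≢q = contradiction
    (count⇒↭ _ _ λ k → trans (count-m S (λ _ → refl) p k)
                         (trans (eq k) (sym (count-m S (λ _ → refl) q k))))
    (res (f p) (f q) (false⇒∉ p∉) (false⇒∉ q∉) (p≢q ∘ at-injective tree p q))

  Resolving⇒outer : (S : Subset order) {σ : Colouring ℓ} → (∀ p → lookup S (f p) ≡ σ p) →
                    Resolving σ → OuterMultisetResolving S
  Resolving⇒outer S S≗σ res u v u∉ v∉ u≢v u↭v
    with p , refl ← at-position tree u | q , refl ← at-position tree v =
    u≢v (cong f (res p q (trans (sym (S≗σ p)) (∉⇒false u∉)) (trans (sym (S≗σ q)) (∉⇒false v∉))
      λ k → trans (sym (count-m S S≗σ p k)) (trans (sum-↭ (↭.map⁺ _ u↭v)) (count-m S S≗σ q k))))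

  vertices-coloured : Colouring ℓ → Subset order
  vertices-coloured σ = Vec.tabulate (σ ∘ proj₁ ∘ at-position tree)

  lookup-coloured : ∀ σ p → lookup (vertices-coloured σ) (f p) ≡ σ p
  lookup-coloured σ p = trans (lookup∘tabulate _ (f p))
    (cong σ (at-injective tree _ _ (proj₂ (at-position tree (f p)))))

corollary5p4 : ∀ (ℓ : ℕ) → 1 ≤ ℓ →
    ∀ (T : ConnectedGraph) → IsFullTree 2 ℓ T →
    ConnectedGraph.IsOuterMultisetDimension T (dimFullBinaryTree ℓ)
corollary5p4 (suc ℓ) _ T full with σ , res , eq ← optimal ℓ =
  (S , Resolving⇒outer T full S S≗σ res , trans (∣∣≡size T full S S≗σ) eq) ,
  -- A competing set is pulled back along `at tree` to a colouring of the same size, to which the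
  -- lower bound applies.
  λ { _ (S′ , res′ , refl) →
      subst (dimFullBinaryTree (suc ℓ) ≤_) (sym (∣∣≡size T full S′ (λ _ → refl)))
        (dim≤size ℓ _ (Resolving⇒LevelResolving (outer⇒Resolving T full res′))) }
  where
  S = vertices-coloured T full σ
  S≗σ = lookup-coloured T full σ
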